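{- Let $M$ and $N$ be matroids with $E(M)\cap E(N)=\{p\}$, where $p$ is neither a loop nor a bridge in either matroid. Suppose $M$ has cycle system $\mathcal{C}=\{C_1,\dots,C_g\}$ and $N$ has cycle system $\mathcal{D}=\{D_1,\dots,D_f\}$. Suppose that $p\in C_1\cap D_1$ and $p\in\mathcal{C}_{[g]}$. Let $\widetilde{\mathcal{C}}=\{C_2,\dots,C_g\}$ and $\widetilde{\mathcal{D}}=\{\widetilde{D}_1,\dots,\widetilde{D}_f\}$, where $$\widetilde{D}_i=\begin{cases} D_i & \text{if } p\notin D_i,\\ (C_1\cup D_i)\setminus\{p\} & \text{if } p\in D_i.\end{cases}$$ Then $\widetilde{\mathcal{C}}\cup\widetilde{\mathcal{D}}$ is a cycle system for the 2-sum $M\oplus_2 N$ along $p$.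
   Context: Matroids are on finite ground sets; $g(M)=|E(M)|-r(M)$ is the corank. A *cycle* of a matroid is a union of circuits. A *bridge* is a coloop. $\mathrm{Cir}(M)$ is the set of circuits of $M$. Unique union: for a family $\mathcal{A}=\{A_1,\dots,A_g\}$ of subsets of a set and $\sigma\subseteq[g]=\{1,\dots,g\}$, $\mathcal{A}_\sigma$ is the set of elements $e\in\bigcup_{i\in\sigma}A_i$ for which there is exactly one $i\in\sigma$ with $e\in A_i$. A *cycle system* for $M$ is a collection $\mathcal{C}=\{C_1,\dots,C_g\}$ of cycles of $M$ with $g=g(M)$ such that for every nonempty $\sigma\subseteq[g]$ the unique union $\mathcal{C}_\sigma$ is dependent in $M$. The *parallel connection* $M\parallel_p N$ is the matroid on $E(M)\cup E(N)$ with circuits $\mathrm{Cir}(M)\cup\mathrm{Cir}(N)\cup\{(C\cup D)\setminus\{p\}: p\in C\in\mathrm{Cir}(M),\ p\in D\in\mathrm{Cir}(N)\}$. The *2-sum* along $p$ is $M\oplus_2 N=(M\parallel_p N)\setminus p$ (deletion of $p$). -}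

module Defs where

open import Data.Bool.Base using (if_then_else_)
open import Data.Empty using (⊥-elim)
open import Data.Fin.Base using (Fin; zero; suc)
open import Data.Fin.Properties using (any?; all?) renaming (_≟_ to _≟ᶠ_)
open import Data.Fin.Subset
open import Data.Fin.Subset.Properties
open import Data.List.Base using (List; []; _∷_; _++_; map; filter)
open import Data.List.Extrema.Nat using (max)
open import Data.List.Relation.Unary.All using (All)
open import Data.Nat.Base using (ℕ; zero; suc; _∸_)
open import Data.Product using (∃!; ∃-syntax; _×_; _,_; proj₁; proj₂)
open import Data.Sum.Base using (_⊎_; inj₁; inj₂)
open import Data.Vec.Base using ([]; _∷_; here; there; tabulate)
open import Data.Vec.Properties using (≡-dec)
import Data.Bool.Properties as Bool
open import Data.Vec.Functional using (Vector)
open import Level using (0ℓ)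
open import Relation.Binary.PropositionalEquality
  using (_≡_; _≢_; refl; sym; trans; cong; subst)
open import Relation.Nullary using (¬_; Dec; yes; no; does)
open import Relation.Nullary.Decidable using (map′; _×-dec_; _→-dec_; _⊎-dec_; ¬?)
open import Relation.Unary using (Pred; Decidable)

private
  variable
    n g : ℕ

_≟ˢ_ : (X Y : Subset n) → Dec (X ≡ Y)
_≟ˢ_ = ≡-dec Bool._≟_

x∈p-y⇒x≢y : ∀ (X : Subset n) {x y} → x ∈ X - y → x ≢ y
x∈p-y⇒x≢y (_ ∷ _) {zero}  ()        refl
x∈p-y⇒x≢y (_ ∷ X) {suc _} (there h) refl = x∈p-y⇒x≢y X h refl

x∈p-y⇒x∈p : ∀ (X : Subset n) {x y} → x ∈ X - y → x ∈ X
x∈p-y⇒x∈p X {y = y} = p─q⊆p X ⁅ y ⁆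

-- A matroid, presented by its circuits.  The ground set is a subset of an
-- ambient set Fin n, so that matroids whose ground sets overlap can be compared.
record Matroid (n : ℕ) : Set₁ where
  field
    E           : Subset n
    Cir         : Pred (Subset n) 0ℓ
    Cir?        : Decidable Cir
    Cir-ground  : ∀ {C} → Cir C → C ⊆ E
    ⊥-notCir    : ¬ Cir ⊥
    Cir-clutter : ∀ {C D} → Cir C → Cir D → C ⊆ D → C ≡ D
    Cir-elim    : ∀ {C D e} → Cir C → Cir D → C ≢ D → e ∈ C → e ∈ D →
                  ∃[ F ] Cir F × F ⊆ (C ∪ D) - e

open Matroid public

Dependent : Matroid n → Pred (Subset n) 0ℓ
Dependent M X = X ⊆ E M × ∃[ C ] Cir M C × C ⊆ X

Dependent? : (M : Matroid n) → Decidable (Dependent M)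
Dependent? M X = (X ⊆? E M) ×-dec anySubset? (λ C → Cir? M C ×-dec (C ⊆? X))

Independent : Matroid n → Pred (Subset n) 0ℓ
Independent M X = X ⊆ E M × ¬ Dependent M X

Independent? : (M : Matroid n) → Decidable (Independent M)
Independent? M X = (X ⊆? E M) ×-dec ¬? (Dependent? M X)

Basis : Matroid n → Pred (Subset n) 0ℓ
Basis M B = Independent M B × (∀ {I} → Independent M I → B ⊆ I → I ≡ B)

Loop : Matroid n → Pred (Fin n) 0ℓ
Loop M e = Cir M ⁅ e ⁆

-- A bridge (coloop) is an element of every basis.
Bridge : Matroid n → Pred (Fin n) 0ℓ
Bridge M e = ∀ {B} → Basis M B → e ∈ B

allSubsets : ∀ n → List (Subset n)
allSubsets zero    = [] ∷ []
allSubsets (suc n) = map (inside ∷_) (allSubsets n) ++ map (outside ∷_) (allSubsets n)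

rank : Matroid n → ℕ
rank {n} M = max 0 (map ∣_∣ (filter (Independent? M) (allSubsets n)))

-- Truncated subtraction is harmless here, because rank M ≤ ∣ E M ∣.
corank : Matroid n → ℕ
corank M = ∣ E M ∣ ∸ rank M

-- The empty union is allowed, so ⊥ is a cycle.
Cycle : Matroid n → Pred (Subset n) 0ℓ
Cycle {n} M X = ∃[ Cs ] All (Cir M) Cs × X ≡ ⋃ Cs

InExactlyOne : Vector (Subset n) g → Subset g → Pred (Fin n) 0ℓ
InExactlyOne 𝒜 σ e = ∃! _≡_ (λ i → i ∈ σ × e ∈ 𝒜 i)

InExactlyOne? : (𝒜 : Vector (Subset n) g) (σ : Subset g) → Decidable (InExactlyOne 𝒜 σ)
InExactlyOne? 𝒜 σ e = map′
  (λ { (i , h , u) → i , h , λ {j} → u j })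
  (λ { (i , h , u) → i , h , λ j → u {j} })
  (any? λ i → P? i ×-dec all? λ j → P? j →-dec (i ≟ᶠ j))
  where
  P? : Decidable (λ i → i ∈ σ × e ∈ 𝒜 i)
  P? i = (i ∈? σ) ×-dec (e ∈? 𝒜 i)

uniqueUnion : Vector (Subset n) g → Subset g → Subset n
uniqueUnion 𝒜 σ = tabulate (λ e → does (InExactlyOne? 𝒜 σ e))

-- The members of a cycle system are automatically distinct: if 𝒞 i ≡ 𝒞 j with
-- i ≢ j, then the unique union over {i , j} is empty, hence not dependent.
record IsCycleSystem (M : Matroid n) (𝒞 : Vector (Subset n) g) : Set where
  field
    size      : g ≡ corank M
    cycles    : ∀ i → Cycle M (𝒞 i)
    dependent : ∀ σ → Nonempty σ → Dependent M (uniqueUnion 𝒞 σ)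

delete : Matroid n → Fin n → Matroid n
delete M p = record
  { E           = E M - p
  ; Cir         = λ C → Cir M C × p ∉ C
  ; Cir?        = λ C → Cir? M C ×-dec ¬? (p ∈? C)
  ; Cir-ground  = λ { (c , p∉C) x∈C → x∈p∧x≢y⇒x∈p-y (Cir-ground M c x∈C) λ { refl → p∉C x∈C } }
  ; ⊥-notCir    = λ { (c , _) → ⊥-notCir M c }
  ; Cir-clutter = λ { (c , _) (d , _) → Cir-clutter M c d }
  ; Cir-elim    = elim
  }
  where
  elim : ∀ {C D e} → Cir M C × p ∉ C → Cir M D × p ∉ D → C ≢ D → e ∈ C → e ∈ D →
         ∃[ F ] (Cir M F × p ∉ F) × F ⊆ (C ∪ D) - e
  elim {C} {D} (c , p∉C) (d , p∉D) C≢D e∈C e∈D with Cir-elim M c d C≢D e∈C e∈D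
  ... | F , f , F⊆ = F , (f , p∉F) , F⊆
    where
    p∉F : p ∉ F
    p∉F p∈F with x∈p∪q⁻ C D (x∈p-y⇒x∈p (C ∪ D) (F⊆ p∈F))
    ... | inj₁ p∈C = p∉C p∈C
    ... | inj₂ p∈D = p∉D p∈D

Glued : Matroid n → Matroid n → Fin n → Pred (Subset n) 0ℓ
Glued M N p X = ∃[ C ] ∃[ D ] (Cir M C × p ∈ C) × (Cir N D × p ∈ D) × X ≡ (C ∪ D) - p

ParallelCir : Matroid n → Matroid n → Fin n → Pred (Subset n) 0ℓ
ParallelCir M N p X = Cir M X ⊎ Cir N X ⊎ Glued M N p X

ParallelCir? : (M N : Matroid n) (p : Fin n) → Decidable (ParallelCir M N p)
ParallelCir? M N p X = Cir? M X ⊎-dec Cir? N X ⊎-dec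
  anySubset? λ C → anySubset? λ D →
    (Cir? M C ×-dec (p ∈? C)) ×-dec (Cir? N D ×-dec (p ∈? D)) ×-dec (X ≟ˢ ((C ∪ D) - p))

private

  Glued-swap : (M N : Matroid n) {p : Fin n} {X : Subset n} → Glued M N p X → Glued N M p X
  Glued-swap M N {p} (C , D , c , d , eq) = D , C , d , c , trans eq (cong (_- p) (∪-comm C D))

  ParallelCir-swap : (M N : Matroid n) {p : Fin n} {X : Subset n} →
                     ParallelCir M N p X → ParallelCir N M p X
  ParallelCir-swap M N (inj₁ c)        = inj₂ (inj₁ c)
  ParallelCir-swap M N (inj₂ (inj₁ d)) = inj₁ d
  ParallelCir-swap M N (inj₂ (inj₂ x)) = inj₂ (inj₂ (Glued-swap M N x))

  glue⁻ : ∀ (C D : Subset n) {p x} → x ∈ (C ∪ D) - p → (x ∈ C ⊎ x ∈ D) × x ≢ p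
  glue⁻ C D h = x∈p∪q⁻ C D (x∈p-y⇒x∈p (C ∪ D) h) , x∈p-y⇒x≢y (C ∪ D) h

  glue⁺ : ∀ {C D : Subset n} {p x} → x ∈ C ⊎ x ∈ D → x ≢ p → x ∈ (C ∪ D) - p
  glue⁺ h = x∈p∧x≢y⇒x∈p-y (x∈p∪q⁺ h)

  -- The facts used about the ordered pair (M , N); each lemma below is applied
  -- both to (M , N) and to (N , M).
  module Half (M N : Matroid n) (p : Fin n)
              (meet : ∀ {x} → x ∈ E M → x ∈ E N → x ≡ p)
              (nonloop : ∀ {C} → Cir M C → ¬ (∀ {x} → x ∈ C → x ≡ p)) where

    Par : Pred (Subset n) 0ℓ
    Par = ParallelCir M N p

    -- In the glued circuit only the M-part can meet E M away from p.
    glued-M : ∀ {C D x} → Cir N D → x ∈ (C ∪ D) - p → x ∈ E M → x ∈ C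
    glued-M {C} {D} d h x∈M with glue⁻ C D h
    ... | inj₁ x∈C , _   = x∈C
    ... | inj₂ x∈D , x≢p = ⊥-elim (x≢p (meet x∈M (Cir-ground N d x∈D)))

    M⊈N : ∀ {C D} → Cir M C → Cir N D → ¬ (C ⊆ D)
    M⊈N c d C⊆D = nonloop c λ x∈C → meet (Cir-ground M c x∈C) (Cir-ground N d (C⊆D x∈C))

    M⊈glued : ∀ {C X} → Cir M C → Glued M N p X → ¬ (C ⊆ X)
    M⊈glued {C} c (C′ , D′ , (c′ , p∈C′) , (d′ , _) , refl) C⊆X =
      proj₂ (glue⁻ C′ D′ (C⊆X (subst (p ∈_) (sym C≡C′) p∈C′))) refl
      where
      C≡C′ : C ≡ C′
      C≡C′ = Cir-clutter M c c′ λ x∈C → glued-M d′ (C⊆X x∈C) (Cir-ground M c x∈C)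

    glued⊈N : ∀ {D X} → Cir N D → Glued M N p X → ¬ (X ⊆ D)
    glued⊈N d (C′ , D′ , (c′ , _) , _ , refl) X⊆D = nonloop c′ all-p
      where
      all-p : ∀ {x} → x ∈ C′ → x ≡ p
      all-p {x} x∈C′ with x ≟ᶠ p
      ... | yes x≡p = x≡p
      ... | no  x≢p = meet (Cir-ground M c′ x∈C′) (Cir-ground N d (X⊆D (glue⁺ (inj₁ x∈C′) x≢p)))

    glued⊆glued : ∀ {C D C′ D′} → Cir M C → Cir M C′ → p ∈ C′ → Cir N D′ →
                  (C ∪ D) - p ⊆ (C′ ∪ D′) - p → C ≡ C′
    glued⊆glued {C} {D} {C′} {D′} c c′ p∈C′ d′ h = Cir-clutter M c c′ C⊆C′
      where
      C⊆C′ : C ⊆ C′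
      C⊆C′ {x} x∈C with x ≟ᶠ p
      ... | yes refl = p∈C′
      ... | no  x≢p  = glued-M d′ (h (glue⁺ (inj₁ x∈C) x≢p)) (Cir-ground M c x∈C)

    glued-nonempty : ∀ {X} → Glued M N p X → X ≢ ⊥
    glued-nonempty (C , D , (c , _) , _ , refl) eq = nonloop c all-p
      where
      all-p : ∀ {x} → x ∈ C → x ≡ p
      all-p {x} x∈C with x ≟ᶠ p
      ... | yes x≡p = x≡p
      ... | no  x≢p = ⊥-elim (∉⊥ (subst (x ∈_) eq (glue⁺ (inj₁ x∈C) x≢p)))

    elim-MM : ∀ {C D e} → Cir M C → Cir M D → C ≢ D → e ∈ C → e ∈ D →
              ∃[ F ] Par F × F ⊆ (C ∪ D) - e
    elim-MM c d C≢D e∈C e∈D with Cir-elim M c d C≢D e∈C e∈D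
    ... | F , f , F⊆ = F , inj₁ f , F⊆

    elim-MN : ∀ {C D e} → Cir M C → Cir N D → e ∈ C → e ∈ D →
              ∃[ F ] Par F × F ⊆ (C ∪ D) - e
    elim-MN {C} {D} c d e∈C e∈D with meet (Cir-ground M c e∈C) (Cir-ground N d e∈D)
    ... | refl = (C ∪ D) - p , inj₂ (inj₂ (C , D , (c , e∈C) , (d , e∈D) , refl)) , λ h → h

    elim-MG : ∀ {C X e} → Cir M C → Glued M N p X → e ∈ C → e ∈ X →
              ∃[ F ] Par F × F ⊆ (C ∪ X) - e
    elim-MG {C} {e = e} c (C′ , D′ , (c′ , p∈C′) , (d′ , p∈D′) , refl) e∈C e∈X = split (C ≟ˢ C′)
      where
      X : Subset _
      X = (C′ ∪ D′) - p

      e∈M : e ∈ E M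
      e∈M = Cir-ground M c e∈C

      e≢p : e ≢ p
      e≢p = proj₂ (glue⁻ C′ D′ e∈X)

      e∉N : ∀ {x} → x ∈ E N → x ≢ e
      e∉N x∈N refl = e≢p (meet e∈M x∈N)

      split : Dec (C ≡ C′) → ∃[ F ] Par F × F ⊆ (C ∪ X) - e
      split (yes refl) = D′ , inj₂ (inj₁ d′) , D′⊆
        where
        D′⊆ : D′ ⊆ (C ∪ X) - e
        D′⊆ {x} x∈D′ with x ≟ᶠ p
        ... | yes refl = glue⁺ (inj₁ p∈C′) (e∉N (Cir-ground N d′ x∈D′))
        ... | no  x≢p  = glue⁺ (inj₂ (glue⁺ (inj₂ x∈D′) x≢p)) (e∉N (Cir-ground N d′ x∈D′))
      split (no C≢C′) with Cir-elim M c c′ C≢C′ e∈C (glued-M d′ e∈X e∈M)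
      ... | F , f , F⊆ = result (p ∈? F)
        where
        F-away : ∀ {x} → x ∈ F → x ≢ p → x ∈ (C ∪ X) - e
        F-away x∈F x≢p with glue⁻ C C′ (F⊆ x∈F)
        ... | inj₁ x∈C  , x≢e = glue⁺ (inj₁ x∈C) x≢e
        ... | inj₂ x∈C′ , x≢e = glue⁺ (inj₂ (glue⁺ (inj₁ x∈C′) x≢p)) x≢e

        result : Dec (p ∈ F) → ∃[ G ] Par G × G ⊆ (C ∪ X) - e
        result (no p∉F) = F , inj₁ f , λ x∈F → F-away x∈F λ { refl → p∉F x∈F }
        result (yes p∈F) =
          (F ∪ D′) - p , inj₂ (inj₂ (F , D′ , (f , p∈F) , (d′ , p∈D′) , refl)) , G⊆
          where
          G⊆ : (F ∪ D′) - p ⊆ (C ∪ X) - e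
          G⊆ h with glue⁻ F D′ h
          ... | inj₁ x∈F  , x≢p = F-away x∈F x≢p
          ... | inj₂ x∈D′ , x≢p =
            glue⁺ (inj₂ (glue⁺ (inj₂ x∈D′) x≢p)) (e∉N (Cir-ground N d′ x∈D′))

    elim-GG : ∀ {X Y e} → Glued M N p X → Glued M N p Y → X ≢ Y → e ∈ X → e ∈ Y → e ∈ E M →
              ∃[ F ] Par F × F ⊆ (X ∪ Y) - e
    elim-GG {e = e} (C , D , (c , p∈C) , (d , p∈D) , refl) (C′ , D′ , (c′ , p∈C′) , (d′ , p∈D′) , refl)
            X≢Y e∈X e∈Y e∈M = split (C ≟ˢ C′)
      where
      X Y : Subset _
      X = (C ∪ D) - p
      Y = (C′ ∪ D′) - p

      e≢p : e ≢ p
      e≢p = proj₂ (glue⁻ C D e∈X)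

      e∉N : ∀ {x} → x ∈ E N → x ≢ e
      e∉N x∈N refl = e≢p (meet e∈M x∈N)

      split : Dec (C ≡ C′) → ∃[ F ] Par F × F ⊆ (X ∪ Y) - e
      split (yes refl) with Cir-elim N d d′ (λ { refl → X≢Y refl }) p∈D p∈D′
      ... | F , f , F⊆ = F , inj₂ (inj₁ f) , F⊆′
        where
        F⊆′ : F ⊆ (X ∪ Y) - e
        F⊆′ x∈F with glue⁻ D D′ (F⊆ x∈F)
        ... | inj₁ x∈D  , x≢p = glue⁺ (inj₁ (glue⁺ (inj₂ x∈D) x≢p)) (e∉N (Cir-ground N d x∈D))
        ... | inj₂ x∈D′ , x≢p = glue⁺ (inj₂ (glue⁺ (inj₂ x∈D′) x≢p)) (e∉N (Cir-ground N d′ x∈D′))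
      split (no C≢C′) with Cir-elim M c c′ C≢C′ (glued-M d e∈X e∈M) (glued-M d′ e∈Y e∈M)
      ... | F , f , F⊆ = result (p ∈? F)
        where
        F-away : ∀ {x} → x ∈ F → x ≢ p → x ∈ (X ∪ Y) - e
        F-away x∈F x≢p with glue⁻ C C′ (F⊆ x∈F)
        ... | inj₁ x∈C  , x≢e = glue⁺ (inj₁ (glue⁺ (inj₁ x∈C) x≢p)) x≢e
        ... | inj₂ x∈C′ , x≢e = glue⁺ (inj₂ (glue⁺ (inj₁ x∈C′) x≢p)) x≢e

        result : Dec (p ∈ F) → ∃[ G ] Par G × G ⊆ (X ∪ Y) - e
        result (no p∉F) = F , inj₁ f , λ x∈F → F-away x∈F λ { refl → p∉F x∈F }
        result (yes p∈F) =
          (F ∪ D) - p , inj₂ (inj₂ (F , D , (f , p∈F) , (d , p∈D) , refl)) , G⊆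
          where
          G⊆ : (F ∪ D) - p ⊆ (X ∪ Y) - e
          G⊆ h with glue⁻ F D h
          ... | inj₁ x∈F , x≢p = F-away x∈F x≢p
          ... | inj₂ x∈D , x≢p = glue⁺ (inj₁ (glue⁺ (inj₂ x∈D) x≢p)) (e∉N (Cir-ground N d x∈D))

  nonloop⇒ : (M : Matroid n) {p : Fin n} → ¬ Loop M p →
             ∀ {C} → Cir M C → ¬ (∀ {x} → x ∈ C → x ≡ p)
  nonloop⇒ M {p} ¬loop {C} c all-p with p ∈? C
  ... | no  p∉C = ⊥-notCir M (subst (Cir M) (Empty-unique λ { (x , x∈C) →
                    p∉C (subst (_∈ C) (all-p x∈C) x∈C) }) c)
  ... | yes p∈C = ¬loop (subst (Cir M) (⊆-antisym
                    (λ x∈C → subst (_∈ ⁅ p ⁆) (sym (all-p x∈C)) (x∈⁅x⁆ p))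
                    (λ x∈p → subst (_∈ C) (sym (x∈⁅y⁆⇒x≡y p x∈p)) p∈C)) c)

-- The hypothesis that p is not a loop is needed for the family ParallelCir to
-- be the circuits of a matroid.
parallelConnection : (M N : Matroid n) (p : Fin n) → E M ∩ E N ≡ ⁅ p ⁆ →
                     ¬ Loop M p → ¬ Loop N p → Matroid n
parallelConnection {n} M N p meet ¬loopM ¬loopN = record
  { E           = E M ∪ E N
  ; Cir         = ParallelCir M N p
  ; Cir?        = ParallelCir? M N p
  ; Cir-ground  = ground
  ; ⊥-notCir    = λ { (inj₁ c)        → ⊥-notCir M c
                    ; (inj₂ (inj₁ d)) → ⊥-notCir N d
                    ; (inj₂ (inj₂ x)) → MN.glued-nonempty x refl }
  ; Cir-clutter = clutter
  ; Cir-elim    = elim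
  }
  where
  meet′ : ∀ {x} → x ∈ E M → x ∈ E N → x ≡ p
  meet′ x∈M x∈N = x∈⁅y⁆⇒x≡y p (subst (_ ∈_) meet (x∈p∩q⁺ (x∈M , x∈N)))

  module MN = Half M N p meet′ (nonloop⇒ M ¬loopM)
  module NM = Half N M p (λ x∈N x∈M → meet′ x∈M x∈N) (nonloop⇒ N ¬loopN)

  ground : ∀ {X} → ParallelCir M N p X → X ⊆ E M ∪ E N
  ground (inj₁ c)        h = x∈p∪q⁺ (inj₁ (Cir-ground M c h))
  ground (inj₂ (inj₁ d)) h = x∈p∪q⁺ (inj₂ (Cir-ground N d h))
  ground (inj₂ (inj₂ (C , D , (c , _) , (d , _) , refl))) h with glue⁻ C D h
  ... | inj₁ x∈C , _ = x∈p∪q⁺ (inj₁ (Cir-ground M c x∈C))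
  ... | inj₂ x∈D , _ = x∈p∪q⁺ (inj₂ (Cir-ground N d x∈D))

  clutter : ∀ {X Y} → ParallelCir M N p X → ParallelCir M N p Y → X ⊆ Y → X ≡ Y
  clutter (inj₁ c) (inj₁ c′) h = Cir-clutter M c c′ h
  clutter (inj₁ c) (inj₂ (inj₁ d)) h = ⊥-elim (MN.M⊈N c d h)
  clutter (inj₁ c) (inj₂ (inj₂ y)) h = ⊥-elim (MN.M⊈glued c y h)
  clutter (inj₂ (inj₁ d)) (inj₁ c) h = ⊥-elim (NM.M⊈N d c h)
  clutter (inj₂ (inj₁ d)) (inj₂ (inj₁ d′)) h = Cir-clutter N d d′ h
  clutter (inj₂ (inj₁ d)) (inj₂ (inj₂ y)) h = ⊥-elim (NM.M⊈glued d (Glued-swap M N y) h)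
  clutter (inj₂ (inj₂ x)) (inj₁ c) h = ⊥-elim (NM.glued⊈N c (Glued-swap M N x) h)
  clutter (inj₂ (inj₂ x)) (inj₂ (inj₁ d)) h = ⊥-elim (MN.glued⊈N d x h)
  clutter (inj₂ (inj₂ (C , D , (c , _) , (d , _) , refl)))
          (inj₂ (inj₂ (C′ , D′ , (c′ , p∈C′) , (d′ , p∈D′) , refl))) h
    with MN.glued⊆glued c c′ p∈C′ d′ h
       | NM.glued⊆glued d d′ p∈D′ c′
           (λ {x} y → subst (x ∈_) (cong (_- p) (∪-comm C′ D′))
                        (h (subst (x ∈_) (cong (_- p) (∪-comm D C)) y)))
  ... | refl | refl = refl

  fromNM : ∀ {X Y e} → ∃[ F ] ParallelCir N M p F × F ⊆ (X ∪ Y) - e →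
           ∃[ F ] ParallelCir M N p F × F ⊆ (X ∪ Y) - e
  fromNM (F , f , F⊆) = F , ParallelCir-swap N M f , F⊆

  flipArgs : ∀ {X Y e} → ∃[ F ] ParallelCir M N p F × F ⊆ (X ∪ Y) - e →
             ∃[ F ] ParallelCir M N p F × F ⊆ (Y ∪ X) - e
  flipArgs {X} {Y} {e} (F , f , F⊆) =
    F , f , λ {x} h → subst (λ Z → x ∈ Z - e) (∪-comm X Y) (F⊆ h)

  elim : ∀ {X Y e} → ParallelCir M N p X → ParallelCir M N p Y → X ≢ Y → e ∈ X → e ∈ Y →
         ∃[ F ] ParallelCir M N p F × F ⊆ (X ∪ Y) - e
  elim (inj₁ c) (inj₁ c′) X≢Y e∈X e∈Y = MN.elim-MM c c′ X≢Y e∈X e∈Y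
  elim (inj₁ c) (inj₂ (inj₁ d)) _ e∈X e∈Y = MN.elim-MN c d e∈X e∈Y
  elim (inj₁ c) (inj₂ (inj₂ y)) _ e∈X e∈Y = MN.elim-MG c y e∈X e∈Y
  elim (inj₂ (inj₁ d)) (inj₁ c) _ e∈X e∈Y = fromNM (NM.elim-MN d c e∈X e∈Y)
  elim (inj₂ (inj₁ d)) (inj₂ (inj₁ d′)) X≢Y e∈X e∈Y = fromNM (NM.elim-MM d d′ X≢Y e∈X e∈Y)
  elim (inj₂ (inj₁ d)) (inj₂ (inj₂ y)) _ e∈X e∈Y = fromNM (NM.elim-MG d (Glued-swap M N y) e∈X e∈Y)
  elim (inj₂ (inj₂ x)) (inj₁ c) _ e∈X e∈Y = flipArgs (MN.elim-MG c x e∈Y e∈X)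
  elim (inj₂ (inj₂ x)) (inj₂ (inj₁ d)) _ e∈X e∈Y =
    flipArgs (fromNM (NM.elim-MG d (Glued-swap M N x) e∈Y e∈X))
  elim (inj₂ (inj₂ x)) (inj₂ (inj₂ y)) X≢Y e∈X e∈Y
    with x∈p∪q⁻ (E M) (E N) (ground (inj₂ (inj₂ x)) e∈X)
  ... | inj₁ e∈M = MN.elim-GG x y X≢Y e∈X e∈Y e∈M
  ... | inj₂ e∈N = fromNM (NM.elim-GG (Glued-swap M N x) (Glued-swap M N y) X≢Y e∈X e∈Y e∈N)

twoSum : (M N : Matroid n) (p : Fin n) → E M ∩ E N ≡ ⁅ p ⁆ →
         ¬ Loop M p → ¬ Loop N p → Matroid n
twoSum M N p meet ¬loopM ¬loopN = delete (parallelConnection M N p meet ¬loopM ¬loopN) p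

-- In a 2-sum along p, a member of 𝒟 through p is completed by a cycle C of the
-- other matroid, which is also expected to pass through p.
replaceThrough : Fin n → Subset n → Vector (Subset n) g → Vector (Subset n) g
replaceThrough p C 𝒟 i = if does (p ∈? 𝒟 i) then (C ∪ 𝒟 i) - p else 𝒟 i

{-# OPTIONS --safe #-}

-- The size condition amounts to rank (M ⊕₂ N) + 1 = rank M + rank N.  If I is
-- independent in the 2-sum, then p can be added to I ∩ E M in M or to I ∩ E N in
-- N, since otherwise two circuits through p would glue to a circuit inside I.
-- Conversely a basis B of M avoiding p and a maximum independent set J of N
-- through p give the independent set B ∪ (J - p).
--
-- For dependence, let σ pick members of both families, and let D be a circuit of
-- N in the unique union of the chosen Dᵢ.  If p ∉ D, then D itself survives in
-- the 2-sum.  If p ∈ D, then p lies in exactly one chosen Dᵢ, so seen from M the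
-- modified Dᵢ plays the role of C₁; a circuit C in the unique union of C₁ and
-- the chosen Cⱼ then survives or can be glued to D.
module Submission where

open import Defs
open import Algebra.Properties.CommutativeSemigroup using (interchange)
open import Data.Bool.Base using (true; false)
open import Data.Empty using (⊥-elim)
open import Data.Fin.Base using (Fin; zero; suc; splitAt; join; _↑ˡ_; _↑ʳ_)
open import Data.Fin.Properties using (any?; join-splitAt) renaming (_≟_ to _≟ᶠ_)
open import Data.Fin.Subset
open import Data.Fin.Subset.Properties
open import Data.List.Base using (List; []; _∷_; map; filter)
open import Data.List.Extrema.Nat using (xs≤max; argmax-sel)
open import Data.List.Membership.Propositional using () renaming (_∈_ to _∈ˡ_)
open import Data.List.Membership.Propositional.Properties
  using (∈-map⁺; ∈-map⁻; ∈-++⁺ˡ; ∈-++⁺ʳ; ∈-filter⁺; ∈-filter⁻)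
open import Data.List.Relation.Unary.All as All using ()
open import Data.List.Relation.Unary.Any using (here; there)
open import Data.Nat.Base using (ℕ; suc; _+_; _∸_; _≤_; _<_; s≤s)
open import Data.Nat.Induction using (<-wellFounded; Acc; acc)
open import Data.Nat.Properties
open import Data.Product using (∃-syntax; _×_; _,_; proj₁; proj₂)
open import Data.Sum.Base using (_⊎_; inj₁; inj₂; [_,_]′)
open import Data.Vec.Base using ([]; _∷_; here; there; tabulate; lookup)
open import Data.Vec.Functional using (Vector; tail; _++_)
open import Data.Vec.Functional.Properties using (lookup-++ˡ; lookup-++ʳ)
open import Data.Vec.Properties using (lookup∘tabulate; []=⇒lookup; lookup⇒[]=)
open import Function.Base using (id; _∘_)
open import Relation.Binary.PropositionalEquality
  using (_≡_; _≢_; refl; sym; trans; cong; cong₂; subst; module ≡-Reasoning)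
open import Relation.Nullary using (¬_; Dec; yes; no; does)
open import Relation.Nullary.Decidable using (decidable-stable; _×-dec_; ¬?; dec-true)

-- Cardinalities of finite subsets.

∣p∪q∣+∣p∩q∣≡∣p∣+∣q∣ : ∀ {n} (X Y : Subset n) → ∣ X ∪ Y ∣ + ∣ X ∩ Y ∣ ≡ ∣ X ∣ + ∣ Y ∣
∣p∪q∣+∣p∩q∣≡∣p∣+∣q∣ [] [] = refl
∣p∪q∣+∣p∩q∣≡∣p∣+∣q∣ (false ∷ X) (false ∷ Y) = ∣p∪q∣+∣p∩q∣≡∣p∣+∣q∣ X Y
∣p∪q∣+∣p∩q∣≡∣p∣+∣q∣ (false ∷ X) (true ∷ Y) =
  trans (cong suc (∣p∪q∣+∣p∩q∣≡∣p∣+∣q∣ X Y)) (sym (+-suc ∣ X ∣ ∣ Y ∣))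
∣p∪q∣+∣p∩q∣≡∣p∣+∣q∣ (true ∷ X) (false ∷ Y) = cong suc (∣p∪q∣+∣p∩q∣≡∣p∣+∣q∣ X Y)
∣p∪q∣+∣p∩q∣≡∣p∣+∣q∣ (true ∷ X) (true ∷ Y) =
  cong suc (trans (+-suc ∣ X ∪ Y ∣ ∣ X ∩ Y ∣)
    (trans (cong suc (∣p∪q∣+∣p∩q∣≡∣p∣+∣q∣ X Y)) (sym (+-suc ∣ X ∣ ∣ Y ∣))))

∣p∪q∣≤∣p∣+∣q∣ : ∀ {n} (X Y : Subset n) → ∣ X ∪ Y ∣ ≤ ∣ X ∣ + ∣ Y ∣
∣p∪q∣≤∣p∣+∣q∣ X Y = ≤-trans (m≤m+n _ ∣ X ∩ Y ∣) (≤-reflexive (∣p∪q∣+∣p∩q∣≡∣p∣+∣q∣ X Y))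

disjoint⇒∣p∪q∣≡∣p∣+∣q∣ : ∀ {n} (X Y : Subset n) → (∀ {x} → x ∈ X → x ∉ Y) →
                        ∣ X ∪ Y ∣ ≡ ∣ X ∣ + ∣ Y ∣
disjoint⇒∣p∪q∣≡∣p∣+∣q∣ {n} X Y disj = begin
  ∣ X ∪ Y ∣              ≡⟨ +-identityʳ _ ⟨
  ∣ X ∪ Y ∣ + 0          ≡⟨ cong (∣ X ∪ Y ∣ +_) (sym (trans (cong ∣_∣ X∩Y≡⊥) (∣⊥∣≡0 n))) ⟩
  ∣ X ∪ Y ∣ + ∣ X ∩ Y ∣  ≡⟨ ∣p∪q∣+∣p∩q∣≡∣p∣+∣q∣ X Y ⟩
  ∣ X ∣ + ∣ Y ∣          ∎
  where
  open ≡-Reasoning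
  X∩Y≡⊥ : X ∩ Y ≡ ⊥
  X∩Y≡⊥ = Empty-unique λ { (x , h) → disj (p∩q⊆p X Y h) (p∩q⊆q X Y h) }

x∈p∪⁅y⁆⁻ : ∀ {n} (X : Subset n) {x y} → x ∈ X ∪ ⁅ y ⁆ → x ∈ X ⊎ x ≡ y
x∈p∪⁅y⁆⁻ X {y = y} h with x∈p∪q⁻ X ⁅ y ⁆ h
... | inj₁ x∈X = inj₁ x∈X
... | inj₂ x∈y = inj₂ (x∈⁅y⁆⇒x≡y y x∈y)

x∈p∪⁅x⁆ : ∀ {n} (X : Subset n) x → x ∈ X ∪ ⁅ x ⁆
x∈p∪⁅x⁆ X x = q⊆p∪q X ⁅ x ⁆ (x∈⁅x⁆ x)

∣p∪⁅x⁆∣≡1+∣p∣ : ∀ {n} (X : Subset n) {x} → x ∉ X → ∣ X ∪ ⁅ x ⁆ ∣ ≡ suc ∣ X ∣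
∣p∪⁅x⁆∣≡1+∣p∣ X {x} x∉X = begin
  ∣ X ∪ ⁅ x ⁆ ∣      ≡⟨ disjoint⇒∣p∪q∣≡∣p∣+∣q∣ X ⁅ x ⁆
                          (λ y∈X y∈x → x∉X (subst (_∈ X) (x∈⁅y⁆⇒x≡y x y∈x) y∈X)) ⟩
  ∣ X ∣ + ∣ ⁅ x ⁆ ∣  ≡⟨ cong (∣ X ∣ +_) (∣⁅x⁆∣≡1 x) ⟩
  ∣ X ∣ + 1          ≡⟨ +-comm ∣ X ∣ 1 ⟩
  suc ∣ X ∣          ∎
  where open ≡-Reasoning

[p-x]∪⁅x⁆≡p : ∀ {n} (X : Subset n) {x} → x ∈ X → (X - x) ∪ ⁅ x ⁆ ≡ X
[p-x]∪⁅x⁆≡p X {x} x∈X = ⊆-antisym to from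
  where
  to : (X - x) ∪ ⁅ x ⁆ ⊆ X
  to h with x∈p∪⁅y⁆⁻ (X - x) h
  ... | inj₁ y∈ = x∈p-y⇒x∈p X y∈
  ... | inj₂ refl = x∈X
  from : X ⊆ (X - x) ∪ ⁅ x ⁆
  from {y} y∈X with y ≟ᶠ x
  ... | yes refl = x∈p∪⁅x⁆ (X - x) x
  ... | no  y≢x  = p⊆p∪q ⁅ x ⁆ (x∈p∧x≢y⇒x∈p-y y∈X y≢x)

1+∣p-x∣≡∣p∣ : ∀ {n} (X : Subset n) {x} → x ∈ X → suc ∣ X - x ∣ ≡ ∣ X ∣
1+∣p-x∣≡∣p∣ X {x} x∈X =
  trans (sym (∣p∪⁅x⁆∣≡1+∣p∣ (X - x) (λ h → x∈p-y⇒x≢y X h refl))) (cong ∣_∣ ([p-x]∪⁅x⁆≡p X x∈X))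

∣[p∪⁅x⁆]-y∣≡∣p∣ : ∀ {n} (X : Subset n) {x y} → x ∉ X → y ∈ X ∪ ⁅ x ⁆ →
                  ∣ (X ∪ ⁅ x ⁆) - y ∣ ≡ ∣ X ∣
∣[p∪⁅x⁆]-y∣≡∣p∣ X {x} x∉X y∈ =
  suc-injective (trans (1+∣p-x∣≡∣p∣ (X ∪ ⁅ x ⁆) y∈) (∣p∪⁅x⁆∣≡1+∣p∣ X x∉X))

⊈⇒∃∉ : ∀ {n} {X Y : Subset n} → X ⊈ Y → ∃[ x ] x ∈ X × x ∉ Y
⊈⇒∃∉ {X = X} {Y} X⊈Y with any? (λ x → (x ∈? X) ×-dec ¬? (x ∈? Y))
... | yes found = found
... | no  none  = ⊥-elim (X⊈Y λ {x} x∈X → decidable-stable (x ∈? Y) (λ x∉Y → none (x , x∈X , x∉Y)))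

-- Circuit exchange and the size of independent spanning sets.

module _ {n} (M : Matroid n) where

  -- Spanning without rank or closure: the definition hands over a circuit for each missing element,
  -- and exchange works along that circuit.
  Spans : Subset n → Set
  Spans B = ∀ {x} → x ∈ E M → x ∉ B → Dependent M (B ∪ ⁅ x ⁆)

  circuit⊈independent : ∀ {I C} → Independent M I → Cir M C → C ⊈ I
  circuit⊈independent (I⊆E , ¬dep) c C⊆I = ¬dep (I⊆E , _ , c , C⊆I)

  noCircuit⇒independent : ∀ {I} → I ⊆ E M → (∀ {C} → Cir M C → C ⊈ I) → Independent M I
  noCircuit⇒independent I⊆E none = I⊆E , λ { (_ , _ , c , C⊆I) → none c C⊆I }

  basis⇒spans : ∀ {B} → Basis M B → Spans B
  basis⇒spans {B} ((B⊆E , _) , maximal) {x} x∈E x∉B =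
    decidable-stable (Dependent? M (B ∪ ⁅ x ⁆)) λ ¬dep →
      x∉B (subst (x ∈_) (maximal (B+x⊆E , ¬dep) (p⊆p∪q ⁅ x ⁆)) (x∈p∪⁅x⁆ B x))
    where
    B+x⊆E : B ∪ ⁅ x ⁆ ⊆ E M
    B+x⊆E h with x∈p∪⁅y⁆⁻ B h
    ... | inj₁ y∈B  = B⊆E y∈B
    ... | inj₂ refl = x∈E

  -- Otherwise the circuit would lie inside the independent set `B`.
  new∈circuit : ∀ {B C e} → Independent M B → Cir M C → C ⊆ B ∪ ⁅ e ⁆ → e ∈ C
  new∈circuit {B} {C} {e} indep c C⊆B+e =
    decidable-stable (e ∈? C) λ e∉C → circuit⊈independent indep c λ x∈C →
      [ id , (λ { refl → ⊥-elim (e∉C x∈C) }) ]′ (x∈p∪⁅y⁆⁻ B (C⊆B+e x∈C))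

  -- A circuit `D` left after the exchange would contain `e`, as `C` does, and differ from `C`
  -- because it omits `f`. Eliminating `e` from the two would leave a circuit inside `B`.
  exchange-independent : ∀ {B C e f} → Independent M B → Cir M C → C ⊆ B ∪ ⁅ e ⁆ → f ∈ C →
                         Independent M ((B ∪ ⁅ e ⁆) - f)
  exchange-independent {B} {C} {e} {f} indep c C⊆B+e f∈C = noCircuit⇒independent ground none
    where
    ground : (B ∪ ⁅ e ⁆) - f ⊆ E M
    ground h with x∈p∪⁅y⁆⁻ B (x∈p-y⇒x∈p (B ∪ ⁅ e ⁆) h)
    ... | inj₁ x∈B  = proj₁ indep x∈B
    ... | inj₂ refl = Cir-ground M c (new∈circuit indep c C⊆B+e)

    none : ∀ {D} → Cir M D → D ⊈ (B ∪ ⁅ e ⁆) - f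
    none {D} d D⊆ with Cir-elim M c d (λ { refl → x∈p-y⇒x≢y (B ∪ ⁅ e ⁆) (D⊆ f∈C) refl })
                         (new∈circuit indep c C⊆B+e) (new∈circuit indep d D⊆B+e)
      where
      D⊆B+e : D ⊆ B ∪ ⁅ e ⁆
      D⊆B+e x∈D = x∈p-y⇒x∈p (B ∪ ⁅ e ⁆) (D⊆ x∈D)
    ... | F , fc , F⊆ = circuit⊈independent indep fc F⊆B
      where
      F⊆B : F ⊆ B
      F⊆B {x} x∈F = [ id , (λ x≡e → ⊥-elim (x∈p-y⇒x≢y (C ∪ D) (F⊆ x∈F) x≡e)) ]′
        (x∈p∪⁅y⁆⁻ B ([ C⊆B+e , (λ x∈D → x∈p-y⇒x∈p (B ∪ ⁅ e ⁆) (D⊆ x∈D)) ]′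
          (x∈p∪q⁻ C D (x∈p-y⇒x∈p (C ∪ D) (F⊆ x∈F)))))

  -- For `x ≡ f` the circuit `C` itself witnesses dependence. For other `x`, take a circuit in
  -- `B ∪ ⁅ x ⁆`; if it uses `f`, eliminate `f` against `C`.
  exchange-spans : ∀ {B C e f} → Independent M B → Spans B → Cir M C → C ⊆ B ∪ ⁅ e ⁆ → f ∈ C →
                   Spans ((B ∪ ⁅ e ⁆) - f)
  exchange-spans {B} {C} {e} {f} indep spans c C⊆B+e f∈C {x} x∈E x∉B′ = B′+x⊆E , split (x ≟ᶠ f)
    where
    B′ = (B ∪ ⁅ e ⁆) - f

    B′+x⊆E : B′ ∪ ⁅ x ⁆ ⊆ E M
    B′+x⊆E h with x∈p∪⁅y⁆⁻ B′ h
    ... | inj₁ y∈B′ = proj₁ (exchange-independent indep c C⊆B+e f∈C) y∈B′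
    ... | inj₂ refl = x∈E

    keep : ∀ {y} → y ∈ B ∪ ⁅ e ⁆ → y ≢ f → y ∈ B′ ∪ ⁅ x ⁆
    keep y∈ y≢f = p⊆p∪q ⁅ x ⁆ (x∈p∧x≢y⇒x∈p-y y∈ y≢f)

    split : Dec (x ≡ f) → ∃[ D ] Cir M D × D ⊆ B′ ∪ ⁅ x ⁆
    split (yes refl) = C , c , C⊆
      where
      C⊆ : C ⊆ B′ ∪ ⁅ x ⁆
      C⊆ {y} y∈C with y ≟ᶠ x
      ... | yes refl = x∈p∪⁅x⁆ B′ x
      ... | no  y≢x  = keep (C⊆B+e y∈C) y≢x
    split (no x≢f) = through-x (spans x∈E (λ x∈B → x∉B+e (p⊆p∪q ⁅ e ⁆ x∈B)))
      where
      x∉B+e : x ∉ B ∪ ⁅ e ⁆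
      x∉B+e x∈B+e = x∉B′ (x∈p∧x≢y⇒x∈p-y x∈B+e x≢f)

      through-x : Dependent M (B ∪ ⁅ x ⁆) → ∃[ D ] Cir M D × D ⊆ B′ ∪ ⁅ x ⁆
      through-x (_ , D , d , D⊆B+x) = result (f ∈? D)
        where
        D-away : ∀ {y} → y ∈ D → y ≢ f → y ∈ B′ ∪ ⁅ x ⁆
        D-away y∈D y≢f with x∈p∪⁅y⁆⁻ B (D⊆B+x y∈D)
        ... | inj₁ y∈B  = keep (p⊆p∪q ⁅ e ⁆ y∈B) y≢f
        ... | inj₂ refl = x∈p∪⁅x⁆ B′ x

        result : Dec (f ∈ D) → ∃[ F ] Cir M F × F ⊆ B′ ∪ ⁅ x ⁆
        result (no f∉D) = D , d , λ y∈D → D-away y∈D λ { refl → f∉D y∈D }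
        result (yes f∈D)
          -- The two circuits differ: `D` contains `x`, which lies outside `B ∪ ⁅ e ⁆` and hence
          -- outside `C`.
          with Cir-elim M c d (λ { refl → x∉B+e (C⊆B+e (new∈circuit indep d D⊆B+x)) }) f∈C f∈D
        ... | F , fc , F⊆ = F , fc , F⊆′
          where
          F⊆′ : F ⊆ B′ ∪ ⁅ x ⁆
          F⊆′ y∈F with x∈p-y⇒x≢y (C ∪ D) (F⊆ y∈F) | x∈p∪q⁻ C D (x∈p-y⇒x∈p (C ∪ D) (F⊆ y∈F))
          ... | y≢f | inj₁ y∈C = keep (C⊆B+e y∈C) y≢f
          ... | y≢f | inj₂ y∈D = D-away y∈D y≢f

  -- Exchanging elements of B for elements of J, one at a time, makes J ⊆ B.
  independent-spans⇒maximum : ∀ {B J} → Independent M B → Spans B → Independent M J → ∣ J ∣ ≤ ∣ B ∣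
  independent-spans⇒maximum {J = J} indep spans indepJ = go indep spans (<-wellFounded _)
    where
    go : ∀ {B} → Independent M B → Spans B → Acc _<_ ∣ J ∩ ∁ B ∣ → ∣ J ∣ ≤ ∣ B ∣
    go {B} indep spans (acc rec) with nonempty? (J ∩ ∁ B)
    ... | no  empty = p⊆q⇒∣p∣≤∣q∣ λ {x} x∈J →
      decidable-stable (x ∈? B) λ x∉B → empty (x , x∈p∩q⁺ (x∈J , x∉p⇒x∈∁p x∉B))
    ... | yes (e , e∈J∖B) with x∈p∩q⁻ J (∁ B) e∈J∖B
    ... | e∈J , e∈∁B with spans (proj₁ indepJ e∈J) (x∈∁p⇒x∉p e∈∁B)
    -- As `J` is independent, `C` has an element `f` outside `J`. Trading `f` for `e` removes `e`
    -- from `J ∩ ∁ B` and adds nothing to it, so the recursion terminates.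
    ... | _ , C , c , C⊆B+e with ⊈⇒∃∉ (circuit⊈independent indepJ c)
    ... | f , f∈C , f∉J = subst (∣ J ∣ ≤_) (∣[p∪⁅x⁆]-y∣≡∣p∣ B (x∈∁p⇒x∉p e∈∁B) (C⊆B+e f∈C))
      (go (exchange-independent indep c C⊆B+e f∈C) (exchange-spans indep spans c C⊆B+e f∈C)
          (rec (p⊂q⇒∣p∣<∣q∣ (shrinks , e , e∈J∖B , e∉))))
      where
      B′ = (B ∪ ⁅ e ⁆) - f
      e∈B′ : e ∈ B′
      e∈B′ = x∈p∧x≢y⇒x∈p-y (x∈p∪⁅x⁆ B e) λ { refl → f∉J e∈J }
      e∉ : e ∉ J ∩ ∁ B′
      e∉ h = x∈∁p⇒x∉p (p∩q⊆q J (∁ B′) h) e∈B′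
      shrinks : J ∩ ∁ B′ ⊆ J ∩ ∁ B
      shrinks {y} h with x∈p∩q⁻ J (∁ B′) h
      ... | y∈J , y∈∁B′ = x∈p∩q⁺ (y∈J , x∉p⇒x∈∁p λ y∈B →
        x∈∁p⇒x∉p y∈∁B′ (x∈p∧x≢y⇒x∈p-y (p⊆p∪q ⁅ e ⁆ y∈B) λ { refl → f∉J y∈J }))

-- Rank as the attained maximum size of an independent set.

∈-allSubsets : ∀ {n} (X : Subset n) → X ∈ˡ allSubsets n
∈-allSubsets [] = here refl
∈-allSubsets (true ∷ X) = ∈-++⁺ˡ (∈-map⁺ _ (∈-allSubsets X))
∈-allSubsets {suc n} (false ∷ X) = ∈-++⁺ʳ (map (inside ∷_) (allSubsets n)) (∈-map⁺ _ (∈-allSubsets X))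

module _ {n} (M : Matroid n) where

  independent⇒∣I∣≤rank : ∀ {I} → Independent M I → ∣ I ∣ ≤ rank M
  independent⇒∣I∣≤rank indep = All.lookup
    (xs≤max 0 (map ∣_∣ (filter (Independent? M) (allSubsets n))))
    (∈-map⁺ ∣_∣ (∈-filter⁺ (Independent? M) {xs = allSubsets n} (∈-allSubsets _) indep))

  rank-attained : ∃[ I ] Independent M I × ∣ I ∣ ≡ rank M
  rank-attained with argmax-sel id 0 (map ∣_∣ (filter (Independent? M) (allSubsets n)))
  -- The maximum may be the default value 0 rather than a listed size; the empty set then attains
  -- it, since it contains no circuit.
  ... | inj₁ rank≡0 = ⊥ , noCircuit⇒independent M (⊥-elim ∘ ∉⊥) none , trans (∣⊥∣≡0 n) (sym rank≡0)
    where
    none : ∀ {C} → Cir M C → C ⊈ ⊥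
    none c C⊆⊥ = ⊥-notCir M (subst (Cir M) (⊆-antisym C⊆⊥ ⊥⊆) c)
  ... | inj₂ rank∈ with ∈-map⁻ ∣_∣ rank∈
  ... | I , I∈ , rank≡∣I∣ = I , proj₂ (∈-filter⁻ (Independent? M) {xs = allSubsets n} I∈) , sym rank≡∣I∣

  rank≤∣E∣ : rank M ≤ ∣ E M ∣
  rank≤∣E∣ with rank-attained
  ... | I , (I⊆E , _) , ∣I∣≡rank = subst (_≤ ∣ E M ∣) ∣I∣≡rank (p⊆q⇒∣p∣≤∣q∣ I⊆E)

  -- Bases are maximal only under inclusion. They span, so the exchange argument compares them in
  -- size with a largest independent set.
  basis⇒rank≤∣B∣ : ∀ {B} → Basis M B → rank M ≤ ∣ B ∣
  basis⇒rank≤∣B∣ basis with rank-attained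
  ... | I , indep , ∣I∣≡rank = subst (_≤ _) ∣I∣≡rank
    (independent-spans⇒maximum M (proj₁ basis) (basis⇒spans M basis) indep)

  -- A largest independent set, exchanged if necessary along a circuit through x.
  rank-attained-through : ∀ {x} → x ∈ E M → ¬ Loop M x →
                          ∃[ I ] Independent M I × x ∈ I × ∣ I ∣ ≡ rank M
  rank-attained-through {x} x∈E ¬loop with rank-attained
  ... | I , indep , ∣I∣≡rank with x ∈? I
  ... | yes x∈I = I , indep , x∈I , ∣I∣≡rank
  ... | no  x∉I with Dependent? M (I ∪ ⁅ x ⁆)
  ... | no ¬dep = ⊥-elim (n≮n (rank M) (subst (_≤ rank M)
                    (trans (∣p∪⁅x⁆∣≡1+∣p∣ I x∉I) (cong suc ∣I∣≡rank))
                    (independent⇒∣I∣≤rank (I+x⊆E , ¬dep))))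
    where
    I+x⊆E : I ∪ ⁅ x ⁆ ⊆ E M
    I+x⊆E h with x∈p∪⁅y⁆⁻ I h
    ... | inj₁ y∈I  = proj₁ indep y∈I
    ... | inj₂ refl = x∈E
  ... | yes (_ , C , c , C⊆I+x) with new∈circuit M indep c C⊆I+x
  ... | x∈C with ⊈⇒∃∉ C⊈x
    where
    C⊈x : C ⊈ ⁅ x ⁆
    C⊈x C⊆x = ¬loop (subst (Cir M)
      (⊆-antisym C⊆x λ y∈x → subst (_∈ C) (sym (x∈⁅y⁆⇒x≡y x y∈x)) x∈C) c)
  ... | f , f∈C , f∉x =
    (I ∪ ⁅ x ⁆) - f , exchange-independent M indep c C⊆I+x f∈C ,
    x∈p∧x≢y⇒x∈p-y (x∈p∪⁅x⁆ I x) (λ { refl → f∉x (x∈⁅x⁆ x) }) ,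
    trans (∣[p∪⁅x⁆]-y∣≡∣p∣ I x∉I (C⊆I+x f∈C)) ∣I∣≡rank

-- Cycles as sets covered by the circuits they contain.

∈-⋃⁺ : ∀ {n} {Cs : List (Subset n)} {C x} → C ∈ˡ Cs → x ∈ C → x ∈ ⋃ Cs
∈-⋃⁺ {Cs = C ∷ Cs} (here refl) x∈C = p⊆p∪q (⋃ Cs) x∈C
∈-⋃⁺ {Cs = C ∷ Cs} (there C∈Cs) x∈C = q⊆p∪q C (⋃ Cs) (∈-⋃⁺ C∈Cs x∈C)

∈-⋃⁻ : ∀ {n} (Cs : List (Subset n)) {x} → x ∈ ⋃ Cs → ∃[ C ] C ∈ˡ Cs × x ∈ C
∈-⋃⁻ [] x∈⊥ = ⊥-elim (∉⊥ x∈⊥)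
∈-⋃⁻ (C ∷ Cs) x∈ with x∈p∪q⁻ C (⋃ Cs) x∈
... | inj₁ x∈C = C , here refl , x∈C
... | inj₂ x∈⋃ with ∈-⋃⁻ Cs x∈⋃
... | D , D∈Cs , x∈D = D , there D∈Cs , x∈D

module _ {n} (M : Matroid n) where

  cycle⇒circuitThrough : ∀ {X x} → Cycle M X → x ∈ X → ∃[ C ] Cir M C × x ∈ C × C ⊆ X
  cycle⇒circuitThrough (Cs , cirs , refl) x∈X with ∈-⋃⁻ Cs x∈X
  ... | C , C∈Cs , x∈C = C , All.lookup cirs C∈Cs , x∈C , ∈-⋃⁺ C∈Cs

  -- The list of all circuits inside `X` has union `X`. Being a cycle thus becomes a condition
  -- checked at one element at a time.
  circuitsThrough⇒cycle : ∀ {X} → (∀ {x} → x ∈ X → ∃[ C ] Cir M C × x ∈ C × C ⊆ X) → Cycle M X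
  circuitsThrough⇒cycle {X} through =
    Cs , All.tabulate (proj₁ ∘ member) , ⊆-antisym X⊆⋃ ⋃⊆X
    where
    P? = λ C → Cir? M C ×-dec (C ⊆? X)
    Cs = filter P? (allSubsets n)
    member : ∀ {C} → C ∈ˡ Cs → Cir M C × C ⊆ X
    member C∈Cs = proj₂ (∈-filter⁻ P? {xs = allSubsets n} C∈Cs)
    X⊆⋃ : X ⊆ ⋃ Cs
    X⊆⋃ x∈X with through x∈X
    ... | C , c , x∈C , C⊆X = ∈-⋃⁺ (∈-filter⁺ P? (∈-allSubsets C) (c , C⊆X)) x∈C
    ⋃⊆X : ⋃ Cs ⊆ X
    ⋃⊆X x∈⋃ with ∈-⋃⁻ Cs x∈⋃
    ... | C , C∈Cs , x∈C = proj₂ (member C∈Cs) x∈C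

  cycle⊆E : ∀ {X} → Cycle M X → X ⊆ E M
  cycle⊆E cyc x∈X with cycle⇒circuitThrough cyc x∈X
  ... | C , c , x∈C , _ = Cir-ground M c x∈C

-- Unique unions and their comparison between families.

∈-tabulate⁺ : ∀ {n} (f : Fin n → Side) {i} → f i ≡ inside → i ∈ tabulate f
∈-tabulate⁺ f {i} eq = lookup⇒[]= i (tabulate f) (trans (lookup∘tabulate f i) eq)

∈-tabulate⁻ : ∀ {n} (f : Fin n → Side) {i} → i ∈ tabulate f → f i ≡ inside
∈-tabulate⁻ f {i} h = trans (sym (lookup∘tabulate f i)) ([]=⇒lookup h)

does≡true⇒ : ∀ {P : Set} (P? : Dec P) → does P? ≡ true → P
does≡true⇒ (yes holds) _ = holds

preimage : ∀ {m n} → (Fin m → Fin n) → Subset n → Subset m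
preimage φ σ = tabulate (λ i → lookup σ (φ i))

∈-preimage⁺ : ∀ {m n} (φ : Fin m → Fin n) {σ i} → φ i ∈ σ → i ∈ preimage φ σ
∈-preimage⁺ φ {σ} φi∈σ = ∈-tabulate⁺ (λ i → lookup σ (φ i)) ([]=⇒lookup φi∈σ)

∈-preimage⁻ : ∀ {m n} (φ : Fin m → Fin n) {σ i} → i ∈ preimage φ σ → φ i ∈ σ
∈-preimage⁻ φ {σ} {i} h = lookup⇒[]= (φ i) σ (∈-tabulate⁻ (λ i → lookup σ (φ i)) h)

module _ {n g} (𝒜 : Vector (Subset n) g) (σ : Subset g) where

  ∈-uniqueUnion⁺ : ∀ {e} → InExactlyOne 𝒜 σ e → e ∈ uniqueUnion 𝒜 σ
  ∈-uniqueUnion⁺ {e} h = ∈-tabulate⁺ _ (dec-true (InExactlyOne? 𝒜 σ e) h)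

  ∈-uniqueUnion⁻ : ∀ {e} → e ∈ uniqueUnion 𝒜 σ → InExactlyOne 𝒜 σ e
  ∈-uniqueUnion⁻ {e} h =
    does≡true⇒ (InExactlyOne? 𝒜 σ e) (∈-tabulate⁻ (λ e → does (InExactlyOne? 𝒜 σ e)) h)

-- Each index of `τ` whose set contains `e` is the image of such an index of `σ`; there is only one
-- of the latter, so only one of the former. Fixing `e` allows comparing families that agree only on
-- part of the ground set.
uniqueUnion-transfer :
  ∀ {n a b} (𝒜 : Vector (Subset n) a) (ℬ : Vector (Subset n) b) {σ τ} (φ : Fin a → Fin b) {e} →
  (∀ {i} → i ∈ σ → e ∈ 𝒜 i → φ i ∈ τ × e ∈ ℬ (φ i)) →
  (∀ j → j ∈ τ → e ∈ ℬ j → ∃[ i ] φ i ≡ j × i ∈ σ × e ∈ 𝒜 i) →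
  e ∈ uniqueUnion 𝒜 σ → e ∈ uniqueUnion ℬ τ
uniqueUnion-transfer 𝒜 ℬ {σ} {τ} φ {e} to from e∈ with ∈-uniqueUnion⁻ 𝒜 σ e∈
... | i , (i∈σ , e∈𝒜i) , only = ∈-uniqueUnion⁺ ℬ τ (φ i , to i∈σ e∈𝒜i , unique)
  where
  unique : ∀ {j} → j ∈ τ × e ∈ ℬ j → φ i ≡ j
  unique {j} (j∈τ , e∈ℬj) with from j j∈τ e∈ℬj
  ... | i′ , φi′≡j , i′∈σ , e∈𝒜i′ = trans (cong φ (only (i′∈σ , e∈𝒜i′))) φi′≡j

↑-elim : ∀ m {n} (P : Fin (m + n) → Set) →
         (∀ i → P (i ↑ˡ n)) → (∀ j → P (m ↑ʳ j)) → ∀ k → P k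
↑-elim m {n} P left right k = subst P (join-splitAt m n k) (both (splitAt m k))
  where
  both : ∀ s → P (join m n s)
  both (inj₁ i) = left i
  both (inj₂ j) = right j

∈-avoid : ∀ {n} {X Y : Subset n} {p} → p ∉ X → X ⊆ Y ∪ ⁅ p ⁆ → X ⊆ Y
∈-avoid {Y = Y} p∉X X⊆ x∈X with x∈p∪⁅y⁆⁻ Y (X⊆ x∈X)
... | inj₁ x∈Y  = x∈Y
... | inj₂ refl = ⊥-elim (p∉X x∈X)

-- Circuits, rank and corank of the 2-sum.

module _ {n} (M N : Matroid n) (p : Fin n) (meet : E M ∩ E N ≡ ⁅ p ⁆)
         (¬loopM : ¬ Loop M p) (¬loopN : ¬ Loop N p) where

  private
    S : Matroid n
    S = twoSum M N p meet ¬loopM ¬loopN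

    p∈M×N : p ∈ E M × p ∈ E N
    p∈M×N = x∈p∩q⁻ (E M) (E N) (subst (p ∈_) (sym meet) (x∈⁅x⁆ p))

    meet⁻ : ∀ {x} → x ∈ E M → x ∈ E N → x ≡ p
    meet⁻ x∈M x∈N = x∈⁅y⁆⇒x≡y p (subst (_ ∈_) meet (x∈p∩q⁺ (x∈M , x∈N)))

    glue⁻ : ∀ (C D : Subset n) {x} → x ∈ (C ∪ D) - p → (x ∈ C ⊎ x ∈ D) × x ≢ p
    glue⁻ C D h = x∈p∪q⁻ C D (x∈p-y⇒x∈p (C ∪ D) h) , x∈p-y⇒x≢y (C ∪ D) h

    glue⁺ : ∀ {C D : Subset n} {x} → x ∈ C ⊎ x ∈ D → x ≢ p → x ∈ (C ∪ D) - p
    glue⁺ h = x∈p∧x≢y⇒x∈p-y (x∈p∪q⁺ h)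

  twoSum-glue : ∀ {C D} → Cir M C → p ∈ C → Cir N D → p ∈ D → Cir S ((C ∪ D) - p)
  twoSum-glue {C} {D} c p∈C d p∈D =
    inj₂ (inj₂ (C , D , (c , p∈C) , (d , p∈D) , refl)) , λ p∈ → x∈p-y⇒x≢y (C ∪ D) p∈ refl

  -- A circuit that misses `p` survives alone; two circuits through `p` are glued, which removes
  -- `p`. Both the rank bound and the dependence proof end with this step.
  twoSum-splice : ∀ {X C D} → Cir M C → C ⊆ X ∪ ⁅ p ⁆ → Cir N D → D ⊆ X ∪ ⁅ p ⁆ →
                  ∃[ F ] Cir S F × F ⊆ X
  twoSum-splice {X} {C} {D} c C⊆ d D⊆ with p ∈? C | p ∈? D
  ... | no p∉C | _      = C , (inj₁ c , p∉C) , ∈-avoid p∉C C⊆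
  ... | yes _  | no p∉D = D , (inj₂ (inj₁ d) , p∉D) , ∈-avoid p∉D D⊆
  ... | yes p∈C | yes p∈D = (C ∪ D) - p , twoSum-glue c p∈C d p∈D , glued⊆
    where
    glued⊆ : (C ∪ D) - p ⊆ X
    glued⊆ h with glue⁻ C D h
    ... | x∈C⊎D , x≢p =
      [ id , ⊥-elim ∘ x≢p ]′ (x∈p∪⁅y⁆⁻ X ([ (λ y → C⊆ y) , (λ y → D⊆ y) ]′ x∈C⊎D))

  -- The element `p` is counted in both `E M` and `E N` but is absent from `E S`.
  twoSum-ground-size : 2 + ∣ E S ∣ ≡ ∣ E M ∣ + ∣ E N ∣
  twoSum-ground-size = begin
    2 + ∣ E S ∣                        ≡⟨ cong suc (1+∣p-x∣≡∣p∣ (E M ∪ E N) (p⊆p∪q (E N) (proj₁ p∈M×N))) ⟩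
    1 + ∣ E M ∪ E N ∣                  ≡⟨ +-comm 1 _ ⟩
    ∣ E M ∪ E N ∣ + 1                  ≡⟨ cong (∣ E M ∪ E N ∣ +_) (sym (trans (cong ∣_∣ meet) (∣⁅x⁆∣≡1 p))) ⟩
    ∣ E M ∪ E N ∣ + ∣ E M ∩ E N ∣      ≡⟨ ∣p∪q∣+∣p∩q∣≡∣p∣+∣q∣ (E M) (E N) ⟩
    ∣ E M ∣ + ∣ E N ∣                  ∎
    where open ≡-Reasoning

  twoSum-rank-≤ : suc (rank S) ≤ rank M + rank N
  twoSum-rank-≤ with rank-attained S
  ... | I , indep@(I⊆E , _) , ∣I∣≡rank =
    subst (λ r → suc r ≤ rank M + rank N) ∣I∣≡rank
      (bound (Dependent? M (I ∩ E M ∪ ⁅ p ⁆)) (Dependent? N (I ∩ E N ∪ ⁅ p ⁆)))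
    where
    open ≤-Reasoning

    p∉I : p ∉ I
    p∉I p∈I = x∈p-y⇒x≢y (E M ∪ E N) (I⊆E p∈I) refl

    indepM : Independent M (I ∩ E M)
    indepM = noCircuit⇒independent M (p∩q⊆q I (E M)) λ c C⊆ →
      circuit⊈independent S indep (inj₁ c , p∉I ∘ p∩q⊆p I (E M) ∘ C⊆) (p∩q⊆p I (E M) ∘ C⊆)

    indepN : Independent N (I ∩ E N)
    indepN = noCircuit⇒independent N (p∩q⊆q I (E N)) λ d D⊆ →
      circuit⊈independent S indep (inj₂ (inj₁ d) , p∉I ∘ p∩q⊆p I (E N) ∘ D⊆) (p∩q⊆p I (E N) ∘ D⊆)

    ∣I∣≤ : ∣ I ∣ ≤ ∣ I ∩ E M ∣ + ∣ I ∩ E N ∣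
    ∣I∣≤ = ≤-trans (p⊆q⇒∣p∣≤∣q∣ I⊆) (∣p∪q∣≤∣p∣+∣q∣ (I ∩ E M) (I ∩ E N))
      where
      I⊆ : I ⊆ I ∩ E M ∪ I ∩ E N
      I⊆ x∈I with x∈p∪q⁻ (E M) (E N) (x∈p-y⇒x∈p (E M ∪ E N) (I⊆E x∈I))
      ... | inj₁ x∈M = p⊆p∪q (I ∩ E N) (x∈p∩q⁺ (x∈I , x∈M))
      ... | inj₂ x∈N = q⊆p∪q (I ∩ E M) (I ∩ E N) (x∈p∩q⁺ (x∈I , x∈N))

    extended : (L : Matroid n) → p ∈ E L → ¬ Dependent L (I ∩ E L ∪ ⁅ p ⁆) → suc ∣ I ∩ E L ∣ ≤ rank L
    extended L p∈L ¬dep = subst (_≤ rank L) (∣p∪⁅x⁆∣≡1+∣p∣ (I ∩ E L) (p∉I ∘ p∩q⊆p I (E L)))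
      (independent⇒∣I∣≤rank L (ground , ¬dep))
      where
      ground : I ∩ E L ∪ ⁅ p ⁆ ⊆ E L
      ground h with x∈p∪⁅y⁆⁻ (I ∩ E L) h
      ... | inj₁ x∈   = p∩q⊆q I (E L) x∈
      ... | inj₂ refl = p∈L

    widen : ∀ X → I ∩ X ∪ ⁅ p ⁆ ⊆ I ∪ ⁅ p ⁆
    widen X h with x∈p∪q⁻ (I ∩ X) ⁅ p ⁆ h
    ... | inj₁ x∈ = p⊆p∪q ⁅ p ⁆ (p∩q⊆p I X x∈)
    ... | inj₂ x∈ = q⊆p∪q I ⁅ p ⁆ x∈

    bound : Dec (Dependent M (I ∩ E M ∪ ⁅ p ⁆)) → Dec (Dependent N (I ∩ E N ∪ ⁅ p ⁆)) →
            suc ∣ I ∣ ≤ rank M + rank N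
    bound (no ¬depM) _ = begin
      suc ∣ I ∣                            ≤⟨ s≤s ∣I∣≤ ⟩
      suc ∣ I ∩ E M ∣ + ∣ I ∩ E N ∣        ≤⟨ +-mono-≤ (extended M (proj₁ p∈M×N) ¬depM)
                                                      (independent⇒∣I∣≤rank N indepN) ⟩
      rank M + rank N                      ∎
    bound (yes _) (no ¬depN) = begin
      suc ∣ I ∣                            ≤⟨ s≤s ∣I∣≤ ⟩
      suc (∣ I ∩ E M ∣ + ∣ I ∩ E N ∣)      ≡⟨ +-suc ∣ I ∩ E M ∣ ∣ I ∩ E N ∣ ⟨
      ∣ I ∩ E M ∣ + suc ∣ I ∩ E N ∣        ≤⟨ +-mono-≤ (independent⇒∣I∣≤rank M indepM)
                                                      (extended N (proj₂ p∈M×N) ¬depN) ⟩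
      rank M + rank N                      ∎
    bound (yes (_ , C , c , C⊆)) (yes (_ , D , d , D⊆))
      with twoSum-splice c (widen (E M) ∘ C⊆) d (widen (E N) ∘ D⊆)
    ... | F , fc , F⊆I = ⊥-elim (circuit⊈independent S indep fc F⊆I)

  -- The union meets `E M` only in `B` and `E N` only in `J`. A glued circuit is excluded by its `N`
  -- half: restoring `p`, which belongs to `J`, puts that whole circuit of `N` inside `J`.
  twoSum-independent : ∀ {B J} → Independent M B → p ∉ B → Independent N J → p ∈ J →
                       Independent S (B ∪ (J - p))
  twoSum-independent {B} {J} indepB p∉B indepJ p∈J = noCircuit⇒independent S ground none
    where
    K = B ∪ (J - p)

    ground : K ⊆ E S
    ground h with x∈p∪q⁻ B (J - p) h
    ... | inj₁ x∈B = glue⁺ (inj₁ (proj₁ indepB x∈B)) λ { refl → p∉B x∈B }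
    ... | inj₂ x∈J = glue⁺ (inj₂ (proj₁ indepJ (x∈p-y⇒x∈p J x∈J))) (x∈p-y⇒x≢y J x∈J)

    K∩M⊆B : ∀ {x} → x ∈ K → x ∈ E M → x ∈ B
    K∩M⊆B x∈K x∈M with x∈p∪q⁻ B (J - p) x∈K
    ... | inj₁ x∈B = x∈B
    ... | inj₂ x∈J =
      ⊥-elim (x∈p-y⇒x≢y J x∈J (meet⁻ x∈M (proj₁ indepJ (x∈p-y⇒x∈p J x∈J))))

    K∩N⊆J : ∀ {x} → x ∈ K → x ∈ E N → x ∈ J
    K∩N⊆J x∈K x∈N with x∈p∪q⁻ B (J - p) x∈K
    ... | inj₁ x∈B = subst (_∈ J) (sym (meet⁻ (proj₁ indepB x∈B) x∈N)) p∈J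
    ... | inj₂ x∈J = x∈p-y⇒x∈p J x∈J

    none : ∀ {F} → Cir S F → F ⊈ K
    none (inj₁ c , _) F⊆K =
      circuit⊈independent M indepB c λ x∈F → K∩M⊆B (F⊆K x∈F) (Cir-ground M c x∈F)
    none (inj₂ (inj₁ d) , _) F⊆K =
      circuit⊈independent N indepJ d λ x∈F → K∩N⊆J (F⊆K x∈F) (Cir-ground N d x∈F)
    none (inj₂ (inj₂ (C , D , _ , (d , _) , refl)) , _) F⊆K = circuit⊈independent N indepJ d D⊆J
      where
      D⊆J : D ⊆ J
      D⊆J {x} x∈D with x ≟ᶠ p
      ... | yes refl = p∈J
      ... | no  x≢p  = K∩N⊆J (F⊆K (glue⁺ (inj₂ x∈D) x≢p)) (Cir-ground N d x∈D)

  twoSum-rank-≥ : ¬ Bridge M p → rank M + rank N ≤ suc (rank S)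
  twoSum-rank-≥ ¬bridge with rank-attained-through N (proj₂ p∈M×N) ¬loopN
  ... | J , indepJ , p∈J , ∣J∣≡rank =
    -- Not being a bridge is a negated universal and yields no explicit basis avoiding `p`. The
    -- inequality is decidable, so it may be proved by contradiction.
    decidable-stable (_ ≤? _) λ ¬goal → ¬bridge λ {B} basis →
      decidable-stable (p ∈? B) λ p∉B → ¬goal (avoiding basis p∉B)
    where
    open ≤-Reasoning

    avoiding : ∀ {B} → Basis M B → p ∉ B → rank M + rank N ≤ suc (rank S)
    avoiding {B} basis@(indepB , _) p∉B = begin
      rank M + rank N          ≤⟨ +-monoˡ-≤ (rank N) (basis⇒rank≤∣B∣ M basis) ⟩
      ∣ B ∣ + rank N           ≡⟨ cong (∣ B ∣ +_) (trans (sym ∣J∣≡rank) (sym (1+∣p-x∣≡∣p∣ J p∈J))) ⟩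
      ∣ B ∣ + suc ∣ J - p ∣    ≡⟨ +-suc ∣ B ∣ ∣ J - p ∣ ⟩
      suc (∣ B ∣ + ∣ J - p ∣)  ≡⟨ cong suc (sym (disjoint⇒∣p∪q∣≡∣p∣+∣q∣ B (J - p) disjoint)) ⟩
      suc ∣ B ∪ (J - p) ∣      ≤⟨ s≤s (independent⇒∣I∣≤rank S
                                        (twoSum-independent indepB p∉B indepJ p∈J)) ⟩
      suc (rank S)             ∎
      where
      disjoint : ∀ {x} → x ∈ B → x ∉ J - p
      disjoint x∈B x∈J =
        x∈p-y⇒x≢y J x∈J (meet⁻ (proj₁ indepB x∈B) (proj₁ indepJ (x∈p-y⇒x∈p J x∈J)))

  -- Passing to the 2-sum costs two elements and one unit of rank, hence one unit of corank,
  -- matching the removal of `𝒞 zero` from the family.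
  twoSum-corank : ∀ {g f} → ¬ Bridge M p → suc g ≡ corank M → suc f ≡ corank N →
                  g + suc f ≡ corank S
  twoSum-corank {g} {f} ¬bridge sizeM sizeN = begin
    g + suc f                        ≡⟨ m+n∸m≡n (rank S) (g + suc f) ⟨
    rank S + (g + suc f) ∸ rank S    ≡⟨ cong (_∸ rank S) (suc-injective (suc-injective ground)) ⟨
    ∣ E S ∣ ∸ rank S                 ∎
    where
    open ≡-Reasoning
    -- Turning truncated differences into sums lets the count be done by addition alone.
    full : ∀ (L : Matroid n) {k} → k ≡ corank L → ∣ E L ∣ ≡ rank L + k
    full L refl = sym (m+[n∸m]≡n (rank≤∣E∣ L))

    ground : 2 + ∣ E S ∣ ≡ 2 + (rank S + (g + suc f))
    ground = begin
      2 + ∣ E S ∣                              ≡⟨ twoSum-ground-size ⟩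
      ∣ E M ∣ + ∣ E N ∣                        ≡⟨ cong₂ _+_ (full M sizeM) (full N sizeN) ⟩
      (rank M + suc g) + (rank N + suc f)      ≡⟨ interchange +-commutativeSemigroup (rank M) (suc g) (rank N) (suc f) ⟩
      (rank M + rank N) + suc (g + suc f)      ≡⟨ cong (_+ suc (g + suc f))
                                                    (≤-antisym (twoSum-rank-≥ ¬bridge) twoSum-rank-≤) ⟩
      suc (rank S + suc (g + suc f))           ≡⟨ cong suc (+-suc (rank S) (g + suc f)) ⟩
      2 + (rank S + (g + suc f))               ∎

  -- Cycles of the 2-sum.

  twoSum-cycle-glue : ∀ {X Y} → Cycle M X → p ∈ X → Cycle N Y → p ∈ Y → Cycle S ((X ∪ Y) - p)
  twoSum-cycle-glue {X} {Y} cycX p∈X cycY p∈Y = circuitsThrough⇒cycle S through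
    where
    Through = λ x → ∃[ F ] Cir S F × x ∈ F × F ⊆ (X ∪ Y) - p

    glued⊆ : ∀ {C D} → C ⊆ X → D ⊆ Y → (C ∪ D) - p ⊆ (X ∪ Y) - p
    glued⊆ {C} {D} C⊆X D⊆Y h with glue⁻ C D h
    ... | inj₁ x∈C , x≢p = glue⁺ (inj₁ (C⊆X x∈C)) x≢p
    ... | inj₂ x∈D , x≢p = glue⁺ (inj₂ (D⊆Y x∈D)) x≢p

    -- A circuit through `x` inside `X` survives if it misses `p`; otherwise a circuit of `N`
    -- through `p` inside `Y` completes it.
    throughM : ∀ {x} → x ∈ X → x ≢ p → Through x
    throughM x∈X x≢p with cycle⇒circuitThrough M cycX x∈X | cycle⇒circuitThrough N cycY p∈Y
    ... | C , c , x∈C , C⊆X | D , d , p∈D , D⊆Y with p ∈? C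
    ... | yes p∈C = (C ∪ D) - p , twoSum-glue c p∈C d p∈D , glue⁺ (inj₁ x∈C) x≢p , glued⊆ C⊆X D⊆Y
    ... | no  p∉C = C , (inj₁ c , p∉C) , x∈C ,
                    λ y∈C → glue⁺ (inj₁ (C⊆X y∈C)) λ { refl → p∉C y∈C }

    throughN : ∀ {x} → x ∈ Y → x ≢ p → Through x
    throughN x∈Y x≢p with cycle⇒circuitThrough M cycX p∈X | cycle⇒circuitThrough N cycY x∈Y
    ... | C , c , p∈C , C⊆X | D , d , x∈D , D⊆Y with p ∈? D
    ... | yes p∈D = (C ∪ D) - p , twoSum-glue c p∈C d p∈D , glue⁺ (inj₂ x∈D) x≢p , glued⊆ C⊆X D⊆Y
    ... | no  p∉D = D , (inj₂ (inj₁ d) , p∉D) , x∈D ,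
                    λ y∈D → glue⁺ (inj₂ (D⊆Y y∈D)) λ { refl → p∉D y∈D }

    through : ∀ {x} → x ∈ (X ∪ Y) - p → Through x
    through h with glue⁻ X Y h
    ... | inj₁ x∈X , x≢p = throughM x∈X x≢p
    ... | inj₂ x∈Y , x≢p = throughN x∈Y x≢p

  twoSum-cycleˡ : ∀ {X} → Cycle M X → p ∉ X → Cycle S X
  twoSum-cycleˡ {X} cyc p∉X = circuitsThrough⇒cycle S through
    where
    through : ∀ {x} → x ∈ X → ∃[ F ] Cir S F × x ∈ F × F ⊆ X
    through x∈X with cycle⇒circuitThrough M cyc x∈X
    ... | C , c , x∈C , C⊆X = C , (inj₁ c , p∉X ∘ C⊆X) , x∈C , C⊆X

  twoSum-cycleʳ : ∀ {X} → Cycle N X → p ∉ X → Cycle S X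
  twoSum-cycleʳ {X} cyc p∉X = circuitsThrough⇒cycle S through
    where
    through : ∀ {x} → x ∈ X → ∃[ F ] Cir S F × x ∈ F × F ⊆ X
    through x∈X with cycle⇒circuitThrough N cyc x∈X
    ... | D , d , x∈D , D⊆X = D , (inj₂ (inj₁ d) , p∉X ∘ D⊆X) , x∈D , D⊆X

  -- The combined family, its cycles and its unique unions.

  module _ {g f} (𝒞 : Vector (Subset n) (suc g)) (𝒟 : Vector (Subset n) (suc f))
           (sysM : IsCycleSystem M 𝒞) (sysN : IsCycleSystem N 𝒟)
           (p∈C₀ : p ∈ 𝒞 zero) (p∉C₊ : ∀ i → p ∉ 𝒞 (suc i)) where

    private
      open IsCycleSystem

      𝒟̃ : Vector (Subset n) (suc f)
      𝒟̃ = replaceThrough p (𝒞 zero) 𝒟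

      𝒳 : Vector (Subset n) (g + suc f)
      𝒳 = tail 𝒞 ++ 𝒟̃

      𝒳ˡ : ∀ i → 𝒳 (i ↑ˡ suc f) ≡ 𝒞 (suc i)
      𝒳ˡ = lookup-++ˡ (tail 𝒞) 𝒟̃

      𝒳ʳ : ∀ j → 𝒳 (g ↑ʳ j) ≡ 𝒟̃ j
      𝒳ʳ = lookup-++ʳ (tail 𝒞) 𝒟̃

      𝒞⊆M : ∀ i → 𝒞 i ⊆ E M
      𝒞⊆M i = cycle⊆E M (cycles sysM i)

      𝒟⊆N : ∀ i → 𝒟 i ⊆ E N
      𝒟⊆N i = cycle⊆E N (cycles sysN i)

      𝒟̃⁺ : ∀ {i x} → x ∈ 𝒟 i ⊎ (p ∈ 𝒟 i × x ∈ 𝒞 zero) → x ≢ p → x ∈ 𝒟̃ i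
      𝒟̃⁺ {i} {x} h x≢p with p ∈? 𝒟 i | h
      ... | yes _   | inj₁ x∈D           = glue⁺ (inj₂ x∈D) x≢p
      ... | yes _   | inj₂ (_ , x∈C)     = glue⁺ (inj₁ x∈C) x≢p
      ... | no  _   | inj₁ x∈D           = x∈D
      ... | no  p∉D | inj₂ (p∈D , _)     = ⊥-elim (p∉D p∈D)

      𝒟̃⁻ : ∀ {i x} → x ∈ 𝒟̃ i → x ≢ p × (x ∈ 𝒟 i ⊎ (p ∈ 𝒟 i × x ∈ 𝒞 zero))
      𝒟̃⁻ {i} {x} h with p ∈? 𝒟 i
      ... | no  p∉D = (λ { refl → p∉D h }) , inj₁ h
      ... | yes p∈D with glue⁻ (𝒞 zero) (𝒟 i) h
      ... | inj₁ x∈C , x≢p = x≢p , inj₂ (p∈D , x∈C)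
      ... | inj₂ x∈D , x≢p = x≢p , inj₁ x∈D

      -- The sets `𝒟 i` meet `E M` at most in `p`, which no modified set contains. So inside `E M` a
      -- modified set shows only the part inherited from `𝒞 zero`.
      𝒟̃∩M : ∀ {i x} → x ∈ 𝒟̃ i → x ∈ E M → p ∈ 𝒟 i × x ∈ 𝒞 zero
      𝒟̃∩M {i} h x∈M with 𝒟̃⁻ h
      ... | x≢p , inj₁ x∈D = ⊥-elim (x≢p (meet⁻ x∈M (𝒟⊆N i x∈D)))
      ... | _   , inj₂ r   = r

      𝒟̃∩N : ∀ {i x} → x ∈ 𝒟̃ i → x ∈ E N → x ∈ 𝒟 i
      𝒟̃∩N h x∈N with 𝒟̃⁻ h
      ... | _   , inj₁ x∈D       = x∈D
      ... | x≢p , inj₂ (_ , x∈C) = ⊥-elim (x≢p (meet⁻ (𝒞⊆M zero x∈C) x∈N))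

    twoSum-cycles : ∀ k → Cycle S (𝒳 k)
    twoSum-cycles = ↑-elim g (λ k → Cycle S (𝒳 k))
      (λ i → subst (Cycle S) (sym (𝒳ˡ i)) (twoSum-cycleˡ (cycles sysM (suc i)) (p∉C₊ i)))
      (λ j → subst (Cycle S) (sym (𝒳ʳ j)) (cyclẽ j))
      where
      cyclẽ : ∀ j → Cycle S (𝒟̃ j)
      cyclẽ j with p ∈? 𝒟 j
      ... | yes p∈D = twoSum-cycle-glue (cycles sysM zero) p∈C₀ (cycles sysN j) p∈D
      ... | no  p∉D = twoSum-cycleʳ (cycles sysN j) p∉D

    module _ (σ : Subset (g + suc f)) where

      private
        -- Index `i` of `σˡ` stands for `𝒞 (suc i)`. Hence `s ∷ σˡ` is a selection from all of `𝒞`,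
        -- with `s` deciding whether `𝒞 zero` takes part.
        σˡ : Subset g
        σˡ = preimage (_↑ˡ suc f) σ

        σʳ : Subset (suc f)
        σʳ = preimage (g ↑ʳ_) σ

      -- On `E N` away from `p` the family `𝒳` looks like `𝒟`: the remaining members of `𝒞`, and
      -- whatever the modified sets gained, lie in `E M`.
      uniqueUnionʳ : uniqueUnion 𝒟 σʳ ⊆ uniqueUnion 𝒳 σ ∪ ⁅ p ⁆
      uniqueUnionʳ {x} h with x ≟ᶠ p
      ... | yes refl = x∈p∪⁅x⁆ (uniqueUnion 𝒳 σ) p
      ... | no  x≢p  with ∈-uniqueUnion⁻ 𝒟 σʳ h
      ... | i₀ , (_ , x∈D₀) , _ = p⊆p∪q ⁅ p ⁆ (uniqueUnion-transfer 𝒟 𝒳 (g ↑ʳ_) to from h)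
        where
        x∈N : x ∈ E N
        x∈N = 𝒟⊆N i₀ x∈D₀

        to : ∀ {j} → j ∈ σʳ → x ∈ 𝒟 j → g ↑ʳ j ∈ σ × x ∈ 𝒳 (g ↑ʳ j)
        to {j} j∈σʳ x∈D = ∈-preimage⁻ (g ↑ʳ_) j∈σʳ , subst (x ∈_) (sym (𝒳ʳ j)) (𝒟̃⁺ (inj₁ x∈D) x≢p)

        from : ∀ k → k ∈ σ → x ∈ 𝒳 k → ∃[ j ] g ↑ʳ j ≡ k × j ∈ σʳ × x ∈ 𝒟 j
        from = ↑-elim g _
          (λ i _ x∈ → ⊥-elim (x≢p (meet⁻ (𝒞⊆M (suc i) (subst (x ∈_) (𝒳ˡ i) x∈)) x∈N)))
          (λ j j∈σ x∈ → j , refl , ∈-preimage⁺ (g ↑ʳ_) j∈σ , 𝒟̃∩N (subst (x ∈_) (𝒳ʳ j) x∈) x∈N)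

      -- On M the family 𝒳 looks like 𝒞, the member D̃ i₀ playing the role of C₁.
      uniqueUnionˡ : ∀ s i₀ → (s ≡ inside → i₀ ∈ σʳ × p ∈ 𝒟 i₀) →
                     (∀ {i} → i ∈ σʳ → p ∈ 𝒟 i → i₀ ≡ i × s ≡ inside) →
                     uniqueUnion 𝒞 (s ∷ σˡ) ⊆ uniqueUnion 𝒳 σ ∪ ⁅ p ⁆
      uniqueUnionˡ s i₀ present only {x} h with x ≟ᶠ p
      ... | yes refl = x∈p∪⁅x⁆ (uniqueUnion 𝒳 σ) p
      ... | no  x≢p  with ∈-uniqueUnion⁻ 𝒞 (s ∷ σˡ) h
      ... | k₀ , (_ , x∈C₀) , _ = p⊆p∪q ⁅ p ⁆ (uniqueUnion-transfer 𝒞 𝒳 φ to from h)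
        where
        x∈M : x ∈ E M
        x∈M = 𝒞⊆M k₀ x∈C₀

        -- When `s` is `outside`, index `zero` is not selected and its image under `φ` is a mere
        -- placeholder.
        φ : Fin (suc g) → Fin (g + suc f)
        φ zero    = g ↑ʳ i₀
        φ (suc i) = i ↑ˡ suc f

        to : ∀ {i} → i ∈ s ∷ σˡ → x ∈ 𝒞 i → φ i ∈ σ × x ∈ 𝒳 (φ i)
        to {zero} here x∈C with present refl
        ... | i₀∈σʳ , p∈D = ∈-preimage⁻ (g ↑ʳ_) i₀∈σʳ ,
                            subst (x ∈_) (sym (𝒳ʳ i₀)) (𝒟̃⁺ (inj₂ (p∈D , x∈C)) x≢p)
        to {suc i} (there i∈σˡ) x∈C = ∈-preimage⁻ (_↑ˡ suc f) i∈σˡ , subst (x ∈_) (sym (𝒳ˡ i)) x∈C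

        from : ∀ k → k ∈ σ → x ∈ 𝒳 k → ∃[ i ] φ i ≡ k × i ∈ s ∷ σˡ × x ∈ 𝒞 i
        from = ↑-elim g _
          (λ i i∈σ x∈ → suc i , refl , there (∈-preimage⁺ (_↑ˡ suc f) i∈σ) , subst (x ∈_) (𝒳ˡ i) x∈)
          fromʳ
          where
          fromʳ : ∀ j → g ↑ʳ j ∈ σ → x ∈ 𝒳 (g ↑ʳ j) → ∃[ i ] φ i ≡ g ↑ʳ j × i ∈ s ∷ σˡ × x ∈ 𝒞 i
          fromʳ j j∈σ x∈ with 𝒟̃∩M (subst (x ∈_) (𝒳ʳ j) x∈) x∈M
          -- A modified set that meets `E M` comes from a member of `𝒟` through `p`, so `only`
          -- identifies it with `i₀` and forces `s` to be `inside`.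
          ... | p∈D , x∈C with only (∈-preimage⁺ (g ↑ʳ_) j∈σ) p∈D
          ... | refl , refl = zero , refl , here , x∈C

      twoSum-dependent : Nonempty σ → Dependent S (uniqueUnion 𝒳 σ)
      twoSum-dependent (k , k∈σ) = ground , circuit (nonempty? σʳ)
        where
        ground : uniqueUnion 𝒳 σ ⊆ E S
        ground h with ∈-uniqueUnion⁻ 𝒳 σ h
        ... | j , (_ , x∈) , _ = cycle⊆E S (twoSum-cycles j) x∈

        σˡ-nonempty : Empty σʳ → Nonempty σˡ
        σˡ-nonempty empty = ↑-elim g (λ k → k ∈ σ → Nonempty σˡ)
          (λ i i∈σ → i , ∈-preimage⁺ (_↑ˡ suc f) i∈σ)
          (λ j j∈σ → ⊥-elim (empty (j , ∈-preimage⁺ (g ↑ʳ_) j∈σ))) k k∈σ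

        p∉uniqueUnion : p ∉ uniqueUnion 𝒞 (outside ∷ σˡ)
        p∉uniqueUnion h with ∈-uniqueUnion⁻ 𝒞 (outside ∷ σˡ) h
        ... | suc i , (_ , p∈C) , _ = p∉C₊ i p∈C

        circuit : Dec (Nonempty σʳ) → ∃[ F ] Cir S F × F ⊆ uniqueUnion 𝒳 σ
        circuit (no empty) with σˡ-nonempty empty
        -- With no member of `𝒟` chosen, nothing stands in for `𝒞 zero`, so it is left out. The
        -- other members of `𝒞` avoid `p`, and so does the circuit found.
        ... | i , i∈σˡ with dependent sysM (outside ∷ σˡ) (suc i , there i∈σˡ)
        ... | _ , C , c , C⊆ =
          C , (inj₁ c , p∉uniqueUnion ∘ C⊆) ,
          ∈-avoid (p∉uniqueUnion ∘ C⊆)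
            (uniqueUnionˡ outside zero (λ ()) (λ j∈σʳ _ → ⊥-elim (empty (_ , j∈σʳ))) ∘ C⊆)
        circuit (yes nonempty) with dependent sysN σʳ nonempty
        ... | _ , D , d , D⊆ with p ∈? D
        ... | no  p∉D = D , (inj₂ (inj₁ d) , p∉D) , ∈-avoid p∉D (uniqueUnionʳ ∘ D⊆)
        -- Here `p` lies in the unique union, which singles out `i₀`. As its modified set carries a
        -- copy of `𝒞 zero`, the cycle system of `M` is applied with `𝒞 zero` added to the
        -- selection.
        ... | yes p∈D with ∈-uniqueUnion⁻ 𝒟 σʳ (D⊆ p∈D)
                         | dependent sysM (inside ∷ σˡ) (zero , here)
        ... | i₀ , i₀∈ , only | _ , C , c , C⊆ = twoSum-splice c
          (uniqueUnionˡ inside i₀ (λ _ → i₀∈) (λ i∈ p∈ → only (i∈ , p∈) , refl) ∘ C⊆)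
          d (uniqueUnionʳ ∘ D⊆)

proposition3p16 : ∀ {n g f : ℕ} (M N : Matroid n) (p : Fin n)
    (meet : E M ∩ E N ≡ ⁅ p ⁆)
    (¬loopM : ¬ Loop M p) (¬loopN : ¬ Loop N p) →
    ¬ Bridge M p → ¬ Bridge N p →
    (𝒞 : Vector (Subset n) (suc g)) (𝒟 : Vector (Subset n) (suc f)) →
    IsCycleSystem M 𝒞 → IsCycleSystem N 𝒟 →
    p ∈ 𝒞 zero ∩ 𝒟 zero →
    p ∈ uniqueUnion 𝒞 ⊤ →
    IsCycleSystem (twoSum M N p meet ¬loopM ¬loopN) (tail 𝒞 ++ replaceThrough p (𝒞 zero) 𝒟)
proposition3p16 M N p meet ¬loopM ¬loopN ¬bridgeM _ 𝒞 𝒟 sysM sysN p∈C₁∩D₁ p∈𝒞⊤ = record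
  { size      = twoSum-corank M N p meet ¬loopM ¬loopN ¬bridgeM
                  (IsCycleSystem.size sysM) (IsCycleSystem.size sysN)
  ; cycles    = twoSum-cycles M N p meet ¬loopM ¬loopN 𝒞 𝒟 sysM sysN p∈C₁ p∉C₊
  ; dependent = twoSum-dependent M N p meet ¬loopM ¬loopN 𝒞 𝒟 sysM sysN p∈C₁ p∉C₊
  }
  where
  p∈C₁ : p ∈ 𝒞 zero
  p∈C₁ = p∩q⊆p (𝒞 zero) (𝒟 zero) p∈C₁∩D₁

  -- `p` lies in exactly one member of `𝒞`, and `𝒞 zero` already contains it.
  p∉C₊ : ∀ i → p ∉ 𝒞 (suc i)
  p∉C₊ i p∈C with ∈-uniqueUnion⁻ 𝒞 ⊤ p∈𝒞⊤
  ... | _ , _ , only with trans (sym (only (∈⊤ , p∈C₁))) (only (∈⊤ , p∈C))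
  ... | ()
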